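{- Let $n\ge1$, let $\mathcal H\subset\mathbf{RP}^n=\mathbf P(\mathbf R^{n+1})$ be a finite subset and let $\langle u\rangle\in\mathbf{RP}^n\setminus\mathcal H$. Then $$\eta^{\bigstar}_n(\mathcal H\cup\{\langle u\rangle\})=\eta^{\bigstar}_n(\mathcal H)+\eta^{\bigstar}_{n-1}(\mathcal H^{\perp u}),$$ where $\mathcal H^{\perp u}=\{\langle P(w)\rangle : \langle w\rangle\in\mathcal H\}\subset \mathbf P(\langle u\rangle^{\perp})\cong\mathbf{RP}^{n-1}$ and $P:\mathbf R^{n+1}\to\langle u\rangle^\perp$ is the orthogonal projection onto the orthogonal complement of $u$.
   Context: For a real vector space $V$ of dimension $m+1$ let $\mathbf P(V)$ be the set of its $1$-dimensional subspaces; for $v\ne0$ write $\langle v\rangle$ for the line it spans. Let $\mathcal H=\{\langle w_1\rangle,\dots,\langle w_T\rangle\}\subset\mathbf P(V)$ be a finite set of $T$ distinct points, and let an order on $\mathcal H$ be a bijection $\pi:[T]\to\mathcal H$, $\pi(i)=\langle w_i\rangle$. An ordered $m$-tuple $(\langle w_{i_1}\rangle,\dots,\langle w_{i_m}\rangle)$ of distinct elements of $\mathcal H$ satisfies the $\eta^\pi_m(\mathcal H)$ condition if (1) $2\le i_1<\dots<i_m\le T$, and (2) for every $l=1,\dots,m$, $\langle w_{i_l}\rangle$ is the $\pi$-minimal element among all points of $\mathcal H$ contained in $\mathrm{span}(w_{i_l},\dots,w_{i_m})$. Let $B^\pi(\mathcal H)$ be the set of such tuples with $w_{i_1},\dots,w_{i_m}$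 linearly independent. It is a known fact that $|B^\pi(\mathcal H)|$ does not depend on $\pi$; this common value is denoted $\eta^{\bigstar}_m(\mathcal H)$ (defined for finite subsets of $\mathbf P(V)$ for any $(m+1)$-dimensional $V$, in particular for $V=\langle u\rangle^\perp$ with $m=n-1$).
   Formalization: For m = 0 the empty tuple is counted only when the point set is nonempty, so η★_0(∅) = 0; with the literal value 1 the identity fails for n = 1 and H = ∅ (0 on the left, 0 + 1 on the right). -}

module Defs where

open import Level using (0ℓ)
open import Data.Nat as ℕ using (ℕ; zero; suc)
open import Data.Fin as Fin using (Fin; toℕ)
open import Data.Vec as Vec using (Vec; []; _∷_; lookup)
open import Data.List using (List; length)
open import Data.List.Relation.Unary.Unique.Propositional using (Unique)
open import Data.List.Membership.Propositional using (_∈_)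
open import Data.Product using (Σ; ∃; _×_; _,_)
open import Data.Sum using (_⊎_)
open import Function.Bundles using (_⇔_)
open import Relation.Nullary using (¬_)
open import Relation.Binary using (Rel; Decidable)
open import Relation.Binary.PropositionalEquality using (_≡_; _≢_)
open import Algebra.Structures using (IsCommutativeRing)
open import Relation.Binary.Structures using (IsTotalOrder)

-- The real numbers, axiomatised as a Dedekind-complete ordered field
-- (any model is isomorphic to ℝ).  Inverse is total with 0⁻¹ unspecified.
-- Order is assumed decidable (true classically for ℝ).

record RealField : Set₁ where
  infixl 6 _+_
  infixl 7 _*_
  infix  4 _≤_
  field
    Carrier : Set
    _+_ _*_ : Carrier → Carrier → Carrier
    -_      : Carrier → Carrier
    0# 1#   : Carrier
    _⁻¹     : Carrier → Carrier
    _≤_     : Rel Carrier 0ℓ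
    isCommutativeRing : IsCommutativeRing _≡_ _+_ _*_ -_ 0# 1#
    0≢1     : 0# ≢ 1#
    ⁻¹-inverse : ∀ x → x ≢ 0# → x * (x ⁻¹) ≡ 1#
    isTotalOrder : IsTotalOrder _≡_ _≤_
    _≤?_    : Decidable _≤_
    +-mono-≤ : ∀ x y z → x ≤ y → x + z ≤ y + z
    *-nonneg : ∀ x y → 0# ≤ x → 0# ≤ y → 0# ≤ x * y
    complete : (S : Carrier → Set) → ∃ S → (∃ λ b → ∀ x → S x → x ≤ b) →
               ∃ λ s → (∀ x → S x → x ≤ s) × (∀ b → (∀ x → S x → x ≤ b) → s ≤ b)

module LinAlg (R : RealField) where
  open RealField R

  V : ℕ → Set
  V d = Fin d → Carrier

  ∑ : ∀ {k} → (Fin k → Carrier) → Carrier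
  ∑ {zero}  f = 0#
  ∑ {suc k} f = f Fin.zero + ∑ (λ i → f (Fin.suc i))

  _≈ᵥ_ : ∀ {d} → V d → V d → Set
  x ≈ᵥ y = ∀ j → x j ≡ y j

  0ᵥ : ∀ {d} → V d
  0ᵥ _ = 0#

  _•_ : ∀ {d} → Carrier → V d → V d
  (a • x) j = a * x j

  _-ᵥ_ : ∀ {d} → V d → V d → V d
  (x -ᵥ y) j = x j + (- y j)

  _·_ : ∀ {d} → V d → V d → Carrier
  x · y = ∑ (λ j → x j * y j)

  lincomb : ∀ {d k} → (Fin k → Carrier) → (Fin k → V d) → V d
  lincomb c vs j = ∑ (λ p → c p * vs p j)

  LinIndep : ∀ {d k} → (Fin k → V d) → Set
  LinIndep vs = ∀ c → lincomb c vs ≈ᵥ 0ᵥ → ∀ p → c p ≡ 0#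

  InSpan : ∀ {d k} → V d → (Fin k → V d) → Set
  InSpan x vs = ∃ λ c → x ≈ᵥ lincomb c vs

  NonZero : ∀ {d} → V d → Set
  NonZero x = ¬ (x ≈ᵥ 0ᵥ)

  SameLine : ∀ {d} → V d → V d → Set
  SameLine v w = ∃ λ a → a ≢ 0# × w ≈ᵥ (a • v)

  DistinctPoints : ∀ {d T} → (Fin T → V d) → Set
  DistinctPoints ws = (∀ i → NonZero (ws i)) × (∀ i j → SameLine (ws i) (ws j) → i ≡ j)

  SamePointSet : ∀ {d T S} → (Fin T → V d) → (Fin S → V d) → Set
  SamePointSet vs ws = (∀ i → ∃ λ j → SameLine (vs i) (ws j))
                     × (∀ j → ∃ λ i → SameLine (ws j) (vs i))

  proj : ∀ {d} → V d → V d → V d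
  proj u w = w -ᵥ (((w · u) * ((u · u) ⁻¹)) • u)

  -- η^π_m condition and B^π(H), for the order π given by the enumeration ws
  -- (π(i) = ⟨ws i⟩).  Tuples are index vectors (i_1,…,i_m) (0-based).

  module _ {d T : ℕ} (ws : Fin T → V d) where

    -- 1 < i_1 < … < i_m ≤ T in 1-based indexing (with 1 ∈ [T]);
    -- here: 0 < i_1 < … < i_m (0-based), predecessor given
    Increasing : ∀ {k} → ℕ → Vec (Fin T) k → Set
    Increasing prev []       = Data.Unit.⊤ where import Data.Unit
    Increasing prev (i ∷ is) = prev ℕ.< toℕ i × Increasing (toℕ i) is

    Minimal : ∀ {k} → Vec (Fin T) k → Set
    Minimal []         = Data.Unit.⊤ where import Data.Unit
    Minimal (i ∷ is)   =
      (∀ j → InSpan (ws j) (λ p → ws (lookup (i ∷ is) p)) → i Fin.≤ j) × Minimal is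

    InB : (m : ℕ) → Vec (Fin T) m → Set
    InB m is = (0 ℕ.< T) × Increasing 0 is × Minimal is
               × LinIndep (λ p → ws (lookup is p))

  HasCard : ∀ {T m} → (Vec (Fin T) m → Set) → ℕ → Set
  HasCard {T} {m} P k = Σ (List (Vec (Fin T) m)) λ xs →
    Unique xs × length xs ≡ k × (∀ t → P t ⇔ (t ∈ xs))

  -- η★_m(H) = k, computed via the order given by the enumeration ws
  EtaStar : ∀ {d T} → (Fin T → V d) → (m : ℕ) → ℕ → Set
  EtaStar ws m k = HasCard (InB ws m) k

module Submission where

-- Deletion–contraction for no-broken-circuit sets.  If the points are ordered with u
-- last, a tuple satisfying the η condition either avoids u, and is then such a tuple
-- for H, or it ends in u, and its remaining entries form such a tuple in the
-- contraction by u, which is realised by H^{⊥u}.  The same recursion, iterated over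
-- contractions by arbitrary lists K of points, computes the count for any order.
-- Order independence follows from it by exchanging the two largest points x and y: up
-- to the degenerate cases, both orders give the same four terms, namely the counts for
-- the deletion of both, the two mixed minors, and the contraction of both.

open import Defs
import Data.List as List
import Data.Vec as Vec
import Data.Vec.Functional as F
import Data.List.Relation.Unary.All as All
import Data.List.Relation.Unary.All.Properties as All
import Data.List.Relation.Unary.Any as Any
import Data.List.Relation.Unary.Any.Properties as Any
import Data.Vec.Relation.Unary.All as VAll
import Data.List.Relation.Binary.Permutation.Propositional as ↭
import Algebra.Properties.Ring as RingProperties
import Algebra.Solver.Ring.NaturalCoefficients.Default as Solver
open import Algebra.Bundles using (CommutativeRing)
open import Data.Bool using (if_then_else_)
open import Data.Fin as Fin using (Fin; zero; suc; toℕ; fromℕ<)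
open import Data.Fin.Properties using (all?; toℕ-fromℕ<; toℕ-injective; toℕ<n)
open import Data.List using (List; map; length)
open import Data.List.Membership.Propositional using (_∈_; lose; find)
open import Data.List.Membership.Propositional.Properties
  using (∈-++⁻; ∈-++⁺ˡ; ∈-++⁺ʳ; ∈-map⁺; ∈-map⁻)
open import Data.List.Membership.Propositional.Properties.WithK using (unique∧set⇒bag)
open import Data.List.Properties using (map-id; ++-identityʳ; length-++; length-map)
open import Data.List.Relation.Binary.BagAndSetEquality using (∼bag⇒↭)
open import Data.List.Relation.Binary.Permutation.Propositional using (_↭_; prep; swap)
open import Data.List.Relation.Binary.Permutation.Propositional.Properties
  using (Any-resp-↭; All-resp-↭; ∈-resp-↭; shift; ++-comm; ↭-length)
open import Data.List.Relation.Unary.All using (All)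
open import Data.List.Relation.Unary.Any using (Any; here; there)
open import Data.List.Relation.Unary.Unique.Propositional using (Unique)
open import Data.List.Relation.Unary.Unique.Propositional.Properties using (map⁺; ++⁺)
open import Data.Nat using (ℕ; zero; suc)
open import Data.Nat.Tactic.RingSolver using (solve-∀)
open import Data.Product using (∃; _×_; _,_; proj₂)
open import Data.Sum using (inj₁; inj₂)
open import Data.Unit using (⊤; tt)
open import Data.Vec using (Vec; _∷ʳ_; initLast)
open import Data.Vec.Properties using (∷ʳ-injectiveˡ)
open import Function using (_∘_; id)
open import Function.Bundles using (_⇔_; mk⇔; module Equivalence)
open import Level using (0ℓ)
open import Relation.Binary.PropositionalEquality
  using (_≡_; _≢_; refl; sym; trans; cong; cong₂; subst; module ≡-Reasoning)
open import Relation.Binary.Structures using (IsTotalOrder)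
open import Relation.Nullary using (¬_; Dec; yes; no; does; contradiction)
open import Relation.Nullary.Decidable using (dec-true; dec-false)

open Equivalence using (to; from)

-- Matroids presented by their closure relation.

-- K ⊢ x reads: x lies in the flat generated by K.
record Matroid (E : Set) : Set₁ where
  infix 4 _⊢_ _⊢?_
  field
    _⊢_      : List E → E → Set
    _⊢?_     : ∀ K x → Dec (K ⊢ x)
    ⊢-∈      : ∀ {K x} → x ∈ K → K ⊢ x
    ⊢-trans  : ∀ {K K′ x} → (∀ {k} → k ∈ K → K′ ⊢ k) → K ⊢ x → K′ ⊢ x
    exchange : ∀ {K x y} → y List.∷ K ⊢ x → ¬ (K ⊢ x) → x List.∷ K ⊢ y

-- No-broken-circuit counts of minors.

module NBC {E : Set} (M : Matroid E) where
  open Matroid M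
  open import Data.Nat using (_+_)
  open import Data.Nat.Properties using (+-identityʳ)
  open import Data.List using ([]; _∷_; _++_)
  open import Data.List.Relation.Unary.All using ([]; _∷_)

  -- `L` holds the points smaller than `u`. A covered `u` is not minimal in its flat over `K`, so no
  -- admissible tuple over `K` has `u` as its largest entry.
  Covers : List E → E → List E → Set
  Covers K u L = Any (u ∷ K ⊢_) L

  covers? : ∀ K u L → Dec (Covers K u L)
  covers? K u L = Any.any? (u ∷ K ⊢?_) L

  Loopless : List E → List E → Set
  Loopless K L = All (λ x → ¬ (K ⊢ x)) L

  -- The number of m-element no-broken-circuit sets avoiding the minimum, in the
  -- contraction by K of the elements of L, of which the head is the largest.
  -- The flat generated by K and the largest element u of such a set contains no
  -- element smaller than u, and the rest of the set lives in the contraction by u.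
  nbc : List E → List E → ℕ → ℕ
  nbc K []      m       = 0
  nbc K (u ∷ L) zero    = 1
  nbc K (u ∷ L) (suc m) =
    nbc K L (suc m) + (if does (covers? K u L) then 0 else nbc (u ∷ K) L m)

  nbc-covered : ∀ {K u L} m → Covers K u L → nbc K (u ∷ L) m ≡ nbc K L m
  -- Here `c` forces `L` to be nonempty, so both counts are 1.
  nbc-covered {L = _ ∷ _}       zero    c = refl
  nbc-covered {K} {u} {L} (suc m) c
    rewrite dec-true (covers? K u L) c = +-identityʳ _

  nbc-free : ∀ {K u L} m → ¬ Covers K u L →
             nbc K (u ∷ L) (suc m) ≡ nbc K L (suc m) + nbc (u ∷ K) L m
  nbc-free {K} {u} {L} m ¬c rewrite dec-false (covers? K u L) ¬c = refl

  ⊢-↭ : ∀ {K K′ x} → K ↭ K′ → K ⊢ x → K′ ⊢ x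
  ⊢-↭ p = ⊢-trans (⊢-∈ ∘ ∈-resp-↭ p)

  -- The count sees only which flats contain which points. The hypothesis ranges over prefixes `X`
  -- so that a point contracted during the recursion can join the prefix.
  nbc-map : ∀ (g : E → E) {K K′} → (∀ X x → X ++ K ⊢ x ⇔ map g X ++ K′ ⊢ g x) →
            ∀ L m → nbc K L m ≡ nbc K′ (map g L) m
  nbc-map g e []      m       = refl
  nbc-map g e (u ∷ L) zero    = refl
  nbc-map g {K} {K′} e (u ∷ L) (suc m) with covers? K u L
  ... | yes c = trans (+-identityʳ _) (trans (nbc-map g e L (suc m)) (sym
        (nbc-covered (suc m) (Any.map⁺ (Any.map (λ {x} → to (e (u ∷ []) x)) c)))))
  ... | no ¬c = trans
        (cong₂ _+_ (nbc-map g e L (suc m)) (nbc-map g e′ L m))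
        (sym (nbc-free m λ c → ¬c (Any.map (λ {x} → from (e (u ∷ []) x)) (Any.map⁻ c))))
    where
    e′ : ∀ X x → X ++ u ∷ K ⊢ x ⇔ map g X ++ g u ∷ K′ ⊢ g x
    e′ X x = mk⇔
      (⊢-↭ (↭.↭-sym (shift (g u) (map g X) K′)) ∘ to (e (u ∷ X) x) ∘ ⊢-↭ (shift u X K))
      (⊢-↭ (↭.↭-sym (shift u X K)) ∘ from (e (u ∷ X) x) ∘ ⊢-↭ (shift (g u) (map g X) K′))

  ⊢-++ʳ : ∀ X {K K′} → (∀ {k} → k ∈ K → K′ ⊢ k) → ∀ {x} → X ++ K ⊢ x → X ++ K′ ⊢ x
  ⊢-++ʳ X {K} {K′} f = ⊢-trans λ i → go (∈-++⁻ X i)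
    where
    go : ∀ {k} → _ → X ++ K′ ⊢ k
    go (inj₁ i) = ⊢-∈ (∈-++⁺ˡ i)
    go (inj₂ i) = ⊢-trans (⊢-∈ ∘ ∈-++⁺ʳ X) (f i)

  nbc-span : ∀ {K K′} → (∀ {k} → k ∈ K → K′ ⊢ k) → (∀ {k} → k ∈ K′ → K ⊢ k) →
             ∀ L m → nbc K L m ≡ nbc K′ L m
  nbc-span {K} {K′} f g L m =
    trans (nbc-map id e L m) (cong (λ L → nbc K′ L m) (map-id L))
    where
    e : ∀ X x → X ++ K ⊢ x ⇔ map id X ++ K′ ⊢ x
    e X x rewrite map-id X = mk⇔ (⊢-++ʳ X f) (⊢-++ʳ X g)

  ⊢-∷ : ∀ {K K′ x} → K′ ⊢ x → (∀ {k} → k ∈ K → K′ ⊢ k) → ∀ {k} → k ∈ x ∷ K → K′ ⊢ k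
  ⊢-∷ p f (here refl) = p
  ⊢-∷ p f (there i)   = f i

  -- `x ∷ K` and `y ∷ K` generate the same flat, so `x` and `y` are covered simultaneously and have
  -- the same contraction.
  nbc-parallel : ∀ {K x y} → x ∷ K ⊢ y → y ∷ K ⊢ x →
                 ∀ L m → nbc K (x ∷ L) m ≡ nbc K (y ∷ L) m
  nbc-parallel p q L zero    = refl
  nbc-parallel {K} {x} {y} p q L (suc m) with covers? K x L
  ... | yes c = trans (+-identityʳ _)
        (sym (nbc-covered (suc m) (Any.map (⊢-trans (⊢-∷ q (⊢-∈ ∘ there))) c)))
  ... | no ¬c = trans (cong (nbc K L (suc m) +_) (nbc-span x⊆y y⊆x L m))
        (sym (nbc-free m λ c → ¬c (Any.map (⊢-trans y⊆x) c)))
    where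
    x⊆y : ∀ {k} → k ∈ x ∷ K → y ∷ K ⊢ k
    x⊆y = ⊢-∷ q (⊢-∈ ∘ there)
    y⊆x : ∀ {k} → k ∈ y ∷ K → x ∷ K ⊢ k
    y⊆x = ⊢-∷ p (⊢-∈ ∘ there)

  -- Order independence.

  covers-∷ : ∀ {K x y L} → Covers K x L → Covers (y ∷ K) x L
  covers-∷ = Any.map (⊢-trans (⊢-∷ (⊢-∈ (here refl)) (⊢-∈ ∘ there ∘ there)))

  covers-swap : ∀ {K x y L} → Covers (x ∷ K) y L → Covers (y ∷ K) x L
  covers-swap = Any.map (⊢-trans
    (⊢-∷ (⊢-∈ (there (here refl))) (⊢-∷ (⊢-∈ (here refl)) (⊢-∈ ∘ there ∘ there))))

  -- The common increment counts the sets whose two largest elements are x and y.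
  nbc-increment : ∀ {K x y} L m → ∃ λ d →
                  nbc (x ∷ K) (y ∷ L) m ≡ nbc (x ∷ K) L m + d ×
                  nbc (y ∷ K) (x ∷ L) m ≡ nbc (y ∷ K) L m + d
  nbc-increment []      zero = 1 , refl , refl
  nbc-increment (_ ∷ _) zero = 0 , refl , refl
  nbc-increment {K} {x} {y} L (suc m) with covers? (x ∷ K) y L
  ... | yes c = 0 , refl ,
        trans (nbc-covered (suc m) (covers-swap c)) (sym (+-identityʳ _))
  ... | no ¬c = nbc (y ∷ x ∷ K) L m , refl , trans (nbc-free m (¬c ∘ covers-swap))
        (cong (nbc (y ∷ K) L (suc m) +_) (nbc-span
          (⊢-∷ (⊢-∈ (there (here refl))) (⊢-∷ (⊢-∈ (here refl)) (⊢-∈ ∘ there ∘ there)))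
          (⊢-∷ (⊢-∈ (there (here refl))) (⊢-∷ (⊢-∈ (here refl)) (⊢-∈ ∘ there ∘ there))) L m))

  -- A covered `x` contributes nothing, before or after contracting `y`, so both sides reduce to the
  -- count with `x` deleted.
  nbc-swap-covered : ∀ {K x y} L m → Covers K x L → ¬ Covers K y L → ¬ (y ∷ K ⊢ x) →
                     nbc K (x ∷ y ∷ L) (suc m) ≡ nbc K (y ∷ x ∷ L) (suc m)
  nbc-swap-covered {K} {x} {y} L m cx ¬cy ¬q = begin
    nbc K (x ∷ y ∷ L) (suc m)                       ≡⟨ nbc-covered (suc m) (there cx) ⟩
    nbc K (y ∷ L) (suc m)                           ≡⟨ nbc-free m ¬cy ⟩
    nbc K L (suc m) + nbc (y ∷ K) L m
      ≡⟨ cong₂ _+_ (nbc-covered (suc m) cx) (nbc-covered m (covers-∷ cx)) ⟨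
    nbc K (x ∷ L) (suc m) + nbc (y ∷ K) (x ∷ L) m   ≡⟨ nbc-free m (¬cy ∘ Any.tail ¬q) ⟨
    nbc K (y ∷ x ∷ L) (suc m)                       ∎
    where open ≡-Reasoning

  -- If `x` and `y` are parallel over `K`, the larger is covered by the other in both orders; a
  -- point covered by `L` drops out. Otherwise both sides expand into deletion and contraction
  -- terms, and `nbc-increment` matches the double contractions. Looplessness lets `exchange` make
  -- parallelism symmetric.
  nbc-swap : ∀ {K x y} L m → Loopless K (x ∷ y ∷ L) →
             nbc K (x ∷ y ∷ L) m ≡ nbc K (y ∷ x ∷ L) m
  nbc-swap L zero ll = refl
  nbc-swap {K} {x} {y} L (suc m) (¬x ∷ ¬y ∷ _) =
    go (x ∷ K ⊢? y) (covers? K x L) (covers? K y L)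
    where
    open ≡-Reasoning
    interchange : ∀ a b c d → (a + b) + (c + d) ≡ (a + c) + (b + d)
    interchange = solve-∀
    go : Dec (x ∷ K ⊢ y) → Dec (Covers K x L) → Dec (Covers K y L) →
         nbc K (x ∷ y ∷ L) (suc m) ≡ nbc K (y ∷ x ∷ L) (suc m)
    go (yes p) _ _ = begin
      nbc K (x ∷ y ∷ L) (suc m) ≡⟨ nbc-covered (suc m) (here p) ⟩
      nbc K (y ∷ L) (suc m)     ≡⟨ nbc-parallel p q L (suc m) ⟨
      nbc K (x ∷ L) (suc m)     ≡⟨ nbc-covered (suc m) (here q) ⟨
      nbc K (y ∷ x ∷ L) (suc m) ∎
      where q = exchange p ¬y
    go (no ¬p) (yes cx) (yes cy) = trans
      (trans (nbc-covered (suc m) (there cx)) (nbc-covered (suc m) cy))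
      (sym (trans (nbc-covered (suc m) (there cy)) (nbc-covered (suc m) cx)))
    go (no ¬p) (yes cx) (no ¬cy) = nbc-swap-covered L m cx ¬cy (λ q → ¬p (exchange q ¬x))
    go (no ¬p) (no ¬cx) (yes cy) = sym (nbc-swap-covered L m cy ¬cx ¬p)
    go (no ¬p) (no ¬cx) (no ¬cy) with d , eq , eq′ ← nbc-increment {K} {x} {y} L m = begin
      nbc K (x ∷ y ∷ L) (suc m)
        ≡⟨ nbc-free m (¬cx ∘ Any.tail ¬p) ⟩
      nbc K (y ∷ L) (suc m) + nbc (x ∷ K) (y ∷ L) m
        ≡⟨ cong₂ _+_ (nbc-free m ¬cy) eq ⟩
      (nbc K L (suc m) + nbc (y ∷ K) L m) + (nbc (x ∷ K) L m + d)
        ≡⟨ interchange (nbc K L (suc m)) _ _ d ⟩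
      (nbc K L (suc m) + nbc (x ∷ K) L m) + (nbc (y ∷ K) L m + d)
        ≡⟨ cong₂ _+_ (nbc-free m ¬cx) eq′ ⟨
      nbc K (x ∷ L) (suc m) + nbc (y ∷ K) (x ∷ L) m
        ≡⟨ nbc-free m (¬cy ∘ Any.tail λ q → ¬p (exchange q ¬x)) ⟨
      nbc K (y ∷ x ∷ L) (suc m) ∎

  -- An uncovered `x` leaves `L` loopless over `x ∷ K`, so the induction hypothesis, stated for
  -- every `K`, applies to the contraction as well as to the deletion.
  nbc-prep : ∀ {K x L L′} → L ↭ L′ →
             (∀ {K} m → Loopless K L → nbc K L m ≡ nbc K L′ m) →
             ∀ m → Loopless K (x ∷ L) → nbc K (x ∷ L) m ≡ nbc K (x ∷ L′) m
  nbc-prep p ih zero ll = refl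
  nbc-prep {K} {x} {L} p ih (suc m) (_ ∷ ll) with covers? K x L
  ... | yes c = trans (+-identityʳ _)
        (trans (ih (suc m) ll) (sym (nbc-covered (suc m) (Any-resp-↭ p c))))
  ... | no ¬c = trans (cong₂ _+_ (ih (suc m) ll) (ih m (All.¬Any⇒All¬ L ¬c)))
        (sym (nbc-free m (¬c ∘ Any-resp-↭ (↭.↭-sym p))))

  nbc-↭ : ∀ {K L L′} → L ↭ L′ → ∀ m → Loopless K L → nbc K L m ≡ nbc K L′ m
  nbc-↭ ↭.refl       m ll = refl
  nbc-↭ (prep x p)   m ll = nbc-prep p (nbc-↭ p) m ll
  nbc-↭ (swap x y p) m ll@(¬x ∷ ¬y ∷ ll′) = trans (nbc-swap _ m ll)
    (nbc-prep (prep x p) (nbc-prep p (nbc-↭ p)) m (¬y ∷ ¬x ∷ ll′))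
  nbc-↭ (↭.trans p q) m ll = trans (nbc-↭ p m ll) (nbc-↭ q m (All-resp-↭ p ll))

  -- Lists with the same points up to parallelism.

  nbc-absorb : ∀ {K L L′} → All (λ u → Covers K u L) L′ →
               ∀ m → nbc K (L′ ++ L) m ≡ nbc K L m
  nbc-absorb []                    m = refl
  nbc-absorb {L′ = _ ∷ L′} (c ∷ cs) m =
    trans (nbc-covered m (Any.++⁺ʳ L′ c)) (nbc-absorb cs m)

  -- Both lists are compared with their concatenation: whichever list is placed on top is absorbed
  -- by the other, and the two arrangements are permutations of each other.
  nbc-invariant : ∀ {K L L′} → Loopless K L → Loopless K L′ →
                  All (λ u → Covers K u L′) L → All (λ u → Covers K u L) L′ →
                  ∀ m → nbc K L m ≡ nbc K L′ m
  nbc-invariant {K} {L} {L′} ll ll′ c c′ m = begin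
    nbc K L m          ≡⟨ nbc-absorb c′ m ⟨
    nbc K (L′ ++ L) m  ≡⟨ nbc-↭ (++-comm L′ L) m (All.++⁺ ll′ ll) ⟩
    nbc K (L ++ L′) m  ≡⟨ nbc-absorb c m ⟩
    nbc K L′ m         ∎
    where open ≡-Reasoning

-- Arithmetic in ordered fields.

module OrderedField (R : RealField) where
  open RealField R public
  open IsTotalOrder isTotalOrder public using (antisym; reflexive; total)

  commutativeRing : CommutativeRing 0ℓ 0ℓ
  commutativeRing = record { isCommutativeRing = isCommutativeRing }

  open CommutativeRing commutativeRing public using
    ( +-identityˡ; +-identityʳ; +-comm; *-comm; *-assoc; *-identityˡ; zeroˡ; zeroʳ
    ; -‿inverseˡ; -‿inverseʳ; ring; commutativeSemiring)
  open RingProperties ring public using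
    ( -‿distribˡ-*; -‿distribʳ-*; -‿involutive; -1*x≈-x; x∙y⁻¹≈ε⇒x≈y; +-inverseˡ-unique)
  open Solver commutativeSemiring public using (solve; _:+_; _:*_; _:=_)
  open ≡-Reasoning

  _≟_ : ∀ x y → Dec (x ≡ y)
  x ≟ y with x ≤? y | y ≤? x
  ... | yes p | yes q = yes (antisym p q)
  ... | no ¬p | _     = no (¬p ∘ reflexive)
  ... | yes _ | no ¬q = no (¬q ∘ reflexive ∘ sym)

  0≤-x : ∀ {x} → x ≤ 0# → 0# ≤ - x
  0≤-x {x} p = subst (_≤ - x) (-‿inverseʳ x)
    (subst (x + - x ≤_) (+-identityˡ (- x)) (+-mono-≤ x 0# (- x) p))

  0≤x² : ∀ x → 0# ≤ x * x
  0≤x² x with total 0# x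
  ... | inj₁ p = *-nonneg x x p p
  ... | inj₂ p = subst (0# ≤_) square (*-nonneg (- x) (- x) (0≤-x p) (0≤-x p))
    where
    square : - x * - x ≡ x * x
    square = trans (sym (-‿distribˡ-* x (- x)))
      (trans (cong -_ (sym (-‿distribʳ-* x x))) (-‿involutive (x * x)))

  x≤x+y : ∀ {x y} → 0# ≤ y → x ≤ x + y
  x≤x+y {x} {y} p = subst (_≤ x + y) (+-identityˡ x)
    (subst (0# + x ≤_) (+-comm y x) (+-mono-≤ 0# y x p))

  0≤+ : ∀ {x y} → 0# ≤ x → 0# ≤ y → 0# ≤ x + y
  0≤+ p q = IsTotalOrder.trans isTotalOrder p (x≤x+y q)

  +≡0ˡ : ∀ {x y} → 0# ≤ x → 0# ≤ y → x + y ≡ 0# → x ≡ 0#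
  +≡0ˡ {x} p q eq = antisym (subst (x ≤_) eq (x≤x+y q)) p

  inverse-* : ∀ {x} y → x ≢ 0# → x ⁻¹ * (x * y) ≡ y
  inverse-* {x} y x≢0 = begin
    x ⁻¹ * (x * y) ≡⟨ *-assoc (x ⁻¹) x y ⟨
    x ⁻¹ * x * y   ≡⟨ cong (_* y) (trans (*-comm (x ⁻¹) x) (⁻¹-inverse x x≢0)) ⟩
    1# * y         ≡⟨ *-identityˡ y ⟩
    y              ∎

  *-cancel-0 : ∀ {x y} → x ≢ 0# → x * y ≡ 0# → y ≡ 0#
  *-cancel-0 {x} {y} x≢0 eq =
    trans (sym (inverse-* y x≢0)) (trans (cong (x ⁻¹ *_) eq) (zeroʳ (x ⁻¹)))

  x²≡0⇒x≡0 : ∀ {x} → x * x ≡ 0# → x ≡ 0#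
  x²≡0⇒x≡0 {x} eq with x ≟ 0#
  ... | yes p = p
  ... | no ¬p = *-cancel-0 ¬p eq

  ⁻¹≢0 : ∀ {x} → x ≢ 0# → x ⁻¹ ≢ 0#
  ⁻¹≢0 {x} x≢0 eq = 0≢1 (trans (sym (zeroʳ x)) (trans (cong (x *_) (sym eq)) (⁻¹-inverse x x≢0)))

  +-*-0 : ∀ {x y} a → x ≡ 0# → y ≡ 0# → x + a * y ≡ 0#
  +-*-0 a refl refl = trans (+-identityˡ _) (zeroʳ a)

-- Linear maps and orthogonal projection.

module Projections (R : RealField) where
  open OrderedField R
  open LinAlg R
  open ≡-Reasoning
  open import Data.List using ([]; _∷_)
  open import Data.Vec using ([]; _∷_)

  ∑-linear : ∀ {k} a {f g h : Fin k → Carrier} → (∀ i → f i ≡ g i + a * h i) →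
             ∑ f ≡ ∑ g + a * ∑ h
  ∑-linear {zero}  a eq = sym (+-*-0 a refl refl)
  ∑-linear {suc k} a {f} {g} {h} eq = begin
    f zero + ∑ (f ∘ suc)
      ≡⟨ cong₂ _+_ (eq zero) (∑-linear a (eq ∘ suc)) ⟩
    (g zero + a * h zero) + (∑ (g ∘ suc) + a * ∑ (h ∘ suc))
      ≡⟨ solve 5 (λ a x y z w → (x :+ a :* y) :+ (z :+ a :* w) := (x :+ z) :+ a :* (y :+ w))
           refl a (g zero) (h zero) (∑ (g ∘ suc)) (∑ (h ∘ suc)) ⟩
    ∑ g + a * ∑ h ∎

  ∑-0 : ∀ {k} → ∑ {k} (λ _ → 0#) ≡ 0#
  ∑-0 {zero}  = refl
  ∑-0 {suc k} = trans (+-identityˡ _) (∑-0 {k})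

  ∑-nonneg : ∀ {k} {f : Fin k → Carrier} → (∀ i → 0# ≤ f i) → 0# ≤ ∑ f
  ∑-nonneg {zero}  p = reflexive refl
  ∑-nonneg {suc k} p = 0≤+ (p zero) (∑-nonneg (p ∘ suc))

  ∑≡0 : ∀ {k} {f : Fin k → Carrier} → (∀ i → 0# ≤ f i) → ∑ f ≡ 0# → ∀ i → f i ≡ 0#
  ∑≡0 p eq zero    = +≡0ˡ (p zero) (∑-nonneg (p ∘ suc)) eq
  ∑≡0 p eq (suc i) = ∑≡0 (p ∘ suc)
    (+≡0ˡ (∑-nonneg (p ∘ suc)) (p zero) (trans (+-comm _ _) eq)) i

  x·x≡0⇒x≈0 : ∀ {d} {x : V d} → x · x ≡ 0# → x ≈ᵥ 0ᵥ
  x·x≡0⇒x≈0 eq j = x²≡0⇒x≡0 (∑≡0 (λ _ → 0≤x² _) eq j)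

  -- Taking x as a separate variable makes linear maps respect _≈ᵥ_.
  Linear : ∀ {d e} → (V d → V e) → Set
  Linear φ = ∀ a {x y z} → (∀ j → x j ≡ y j + a * z j) → ∀ j → φ x j ≡ φ y j + a * φ z j

  linear-0 : ∀ {d e} {φ : V d → V e} → Linear φ → ∀ {x} → x ≈ᵥ 0ᵥ → φ x ≈ᵥ 0ᵥ
  linear-0 {φ = φ} lin {x} x≈0 j = begin
    -- A zero vector satisfies `x = x + (- 1#) * x`, so linearity applies with `x` in all three
    -- places.
    φ x j                  ≡⟨ lin (- 1#) (λ i → trans (x≈0 i) (sym (+-*-0 _ (x≈0 i) (x≈0 i)))) j ⟩
    φ x j + (- 1#) * φ x j ≡⟨ cong (φ x j +_) (-1*x≈-x (φ x j)) ⟩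
    φ x j + - φ x j        ≡⟨ -‿inverseʳ (φ x j) ⟩
    0#                     ∎

  linear-• : ∀ {d e} {φ : V d → V e} → Linear φ → ∀ {u} → φ u ≈ᵥ 0ᵥ →
             ∀ {a w} → w ≈ᵥ (a • u) → φ w ≈ᵥ 0ᵥ
  linear-• lin φu≈0 {a} eq j = trans (lin a {y = 0ᵥ} (λ i → trans (eq i) (sym (+-identityˡ _))) j)
    (+-*-0 a (linear-0 lin (λ _ → refl) j) (φu≈0 j))

  proj-linear : ∀ {d} (u : V d) → Linear (proj u)
  proj-linear u a {x} {y} {z} eq j = begin
    x j + - ((x · u) * s * u j)
      ≡⟨ cong (x j +_) (-‿distribʳ-* _ (u j)) ⟩
    x j + (x · u) * s * - u j
      ≡⟨ cong₂ (λ p q → p + q * s * - u j) (eq j) x·u ⟩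
    (y j + a * z j) + ((y · u) + a * (z · u)) * s * - u j
      ≡⟨ solve 7 (λ y z u a s p q → (y :+ a :* z) :+ (p :+ a :* q) :* s :* u
                   := (y :+ p :* s :* u) :+ a :* (z :+ q :* s :* u))
           refl (y j) (z j) (- u j) a s (y · u) (z · u) ⟩
    (y j + (y · u) * s * - u j) + a * (z j + (z · u) * s * - u j)
      ≡⟨ cong₂ (λ p q → (y j + p) + a * (z j + q)) (-‿distribʳ-* _ (u j)) (-‿distribʳ-* _ (u j)) ⟨
    proj u y j + a * proj u z j ∎
    where
    s = (u · u) ⁻¹
    x·u : x · u ≡ (y · u) + a * (z · u)
    x·u = ∑-linear a λ i → trans (cong (_* u i) (eq i))
      (solve 4 (λ a y z u → (y :+ a :* z) :* u := y :* u :+ a :* (z :* u)) refl a (y i) (z i) (u i))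

  proj-self : ∀ {d} (u : V d) → proj u u ≈ᵥ 0ᵥ
  proj-self u j with (u · u) ≟ 0#
  -- The inverse of 0 is unspecified, but by positive definiteness `u` itself is zero here.
  ... | yes p = linear-0 (proj-linear u) (x·x≡0⇒x≈0 p) j
  ... | no ¬p = begin
    u j + - ((u · u) * (u · u) ⁻¹ * u j) ≡⟨ cong (λ c → u j + - (c * u j)) (⁻¹-inverse _ ¬p) ⟩
    u j + - (1# * u j)                   ≡⟨ cong (λ x → u j + - x) (*-identityˡ (u j)) ⟩
    u j + - u j                          ≡⟨ -‿inverseʳ (u j) ⟩
    0#                                   ∎

  projCoeff : ∀ {d} → V d → V d → Carrier
  projCoeff u w = (w · u) * (u · u) ⁻¹

  proj-kernel : ∀ {d} (u w : V d) → proj u w ≈ᵥ 0ᵥ → w ≈ᵥ (projCoeff u w • u)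
  proj-kernel u w eq j = x∙y⁻¹≈ε⇒x≈y _ _ (eq j)

  -- `proj u w` differs from `w` by a multiple of `u`, which `φ` kills.
  linear-proj : ∀ {d e} {φ : V d → V e} → Linear φ → ∀ {u} → φ u ≈ᵥ 0ᵥ →
                ∀ w → φ (proj u w) ≈ᵥ φ w
  linear-proj {φ = φ} lin {u} φu≈0 w j = begin
    φ (proj u w) j      ≡⟨ lin (- m) (λ i → cong (w i +_) (-‿distribˡ-* m (u i))) j ⟩
    φ w j + - m * φ u j ≡⟨ cong (λ x → φ w j + - m * x) (φu≈0 j) ⟩
    φ w j + - m * 0#    ≡⟨ cong (φ w j +_) (zeroʳ (- m)) ⟩
    φ w j + 0#          ≡⟨ +-identityʳ _ ⟩
    φ w j               ∎
    where m = projCoeff u w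

  multiple≢0 : ∀ {d} {u w : V d} {a} → NonZero w → w ≈ᵥ (a • u) → a ≢ 0#
  multiple≢0 w≉0 eq refl = w≉0 (λ j → trans (eq j) (zeroˡ _))

  SameLine-sym : ∀ {d} {u w : V d} {a} → a ≢ 0# → w ≈ᵥ (a • u) → u ≈ᵥ ((a ⁻¹) • w)
  SameLine-sym {a = a} a≢0 eq j = sym (trans (cong (a ⁻¹ *_) (eq j)) (inverse-* _ a≢0))

  -- Gram-Schmidt and the matroid of linear spans.

  -- The Gram–Schmidt remainder of x modulo the span of K.
  residual : ∀ {d} → List (V d) → V d → V d
  residual []      x = x
  residual (k ∷ K) x = proj (residual K k) (residual K x)

  residual-linear : ∀ {d} (K : List (V d)) → Linear (residual K)
  residual-linear []      a eq = eq
  residual-linear (k ∷ K) a eq = proj-linear (residual K k) a (residual-linear K a eq)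

  -- Each Gram-Schmidt step subtracts a multiple of a vector that `φ` already kills.
  linear-residual : ∀ {d e} {φ : V d → V e} → Linear φ → ∀ K → (∀ {k} → k ∈ K → φ k ≈ᵥ 0ᵥ) →
                    ∀ x → φ (residual K x) ≈ᵥ φ x
  linear-residual lin []      φK≈0 x j = refl
  linear-residual {φ = φ} lin (k ∷ K) φK≈0 x j = trans
    (linear-proj lin (λ i → trans (ih k i) (φK≈0 (here refl) i)) (residual K x) j) (ih x j)
    where
    ih : ∀ y → φ (residual K y) ≈ᵥ φ y
    ih = linear-residual lin K (φK≈0 ∘ there)

  -- Span membership is encoded by a vanishing remainder, which is decidable coordinatewise;
  -- `⊩⇒InSpan` and `InSpan⇒⊩` compare it with coefficients.
  _⊩_ : ∀ {d} → List (V d) → V d → Set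
  K ⊩ x = residual K x ≈ᵥ 0ᵥ

  ⊩-∈ : ∀ {d K} {x : V d} → x ∈ K → K ⊩ x
  ⊩-∈ {K = k ∷ K} (here refl) = proj-self (residual K k)
  ⊩-∈ {K = k ∷ K} (there i)   = linear-0 (proj-linear (residual K k)) (⊩-∈ i)

  -- `residual K′` is linear and kills `K`, so it takes the same value on `x` and on `residual K x`,
  -- which is zero.
  ⊩-trans : ∀ {d K K′} {x : V d} → (∀ {k} → k ∈ K → K′ ⊩ k) → K ⊩ x → K′ ⊩ x
  ⊩-trans {K = K} {K′} {x} f p j = trans
    (sym (linear-residual (residual-linear K′) K f x j)) (linear-0 (residual-linear K′) p j)

  -- Modulo `K`, `x` is a multiple of `y`. The factor is nonzero since `x` is not in the span of
  -- `K`, and can be inverted.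
  ⊩-exchange : ∀ {d K} {x y : V d} → (y ∷ K) ⊩ x → ¬ (K ⊩ x) → (x ∷ K) ⊩ y
  ⊩-exchange {K = K} {x} {y} p ¬q = linear-• (proj-linear rx) (proj-self rx)
    (SameLine-sym (multiple≢0 ¬q eq) eq)
    where
    rx = residual K x
    eq = proj-kernel (residual K y) rx p

  spanMatroid : ∀ d → Matroid (V d)
  spanMatroid d = record
    { _⊢_      = _⊩_
    ; _⊢?_     = λ K x → all? (λ j → residual K x j ≟ 0#)
    ; ⊢-∈      = λ {K} → ⊩-∈ {K = K}
    ; ⊢-trans  = λ {K} {K′} → ⊩-trans {K = K} {K′}
    ; exchange = λ {K} → ⊩-exchange {K = K}
    }

  -- Comparison with linear combinations and independence.

  linear-lincomb : ∀ {d e k} {φ : V d → V e} → Linear φ → {vs : Fin k → V d} →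
                   (∀ p → φ (vs p) ≈ᵥ 0ᵥ) → ∀ {x} → InSpan x vs → φ x ≈ᵥ 0ᵥ
  linear-lincomb {k = zero}  lin φ≈0 (c , eq) = linear-0 lin eq
  linear-lincomb {k = suc k} lin {vs} φ≈0 (c , eq) j = trans
    (lin (c zero) (λ i → trans (eq i) (+-comm _ _)) j)
    (+-*-0 (c zero)
      (linear-lincomb lin {vs ∘ suc} (φ≈0 ∘ suc) (c ∘ suc , λ _ → refl) j) (φ≈0 zero j))

  family : ∀ {A : Set} {d k} → (A → V d) → Vec A k → Fin k → V d
  family w is p = w (Vec.lookup is p)

  span : ∀ {A : Set} {d k} → (A → V d) → Vec A k → List (V d)
  span w is = map w (Vec.toList is)

  residual-decomposition : ∀ {A : Set} {d k} (w : A → V d) (is : Vec A k) x → ∃ λ c →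
    ∀ j → x j ≡ residual (span w is) x j + lincomb c (family w is) j
  residual-decomposition w []       x = (λ ()) , λ j → sym (+-identityʳ _)
  residual-decomposition w (i ∷ is) x
    with c , x≈ ← residual-decomposition w is x
       | c′ , k≈ ← residual-decomposition w is (w i) = coeffs , decomposition
    where
    rx = residual (span w is) x
    rk = residual (span w is) (w i)
    m  = projCoeff rk rx
    -- The new remainder subtracts `m` times `rk`, and `rk` is `w i` minus its `c′` combination;
    -- hence `m` for `w i` and the correction `- m * c′` to the old coefficients.
    coeffs : Fin _ → Carrier
    coeffs zero    = m
    coeffs (suc p) = c p + - m * c′ p
    decomposition : ∀ j → x j ≡ proj rk rx j + lincomb coeffs (family w (i ∷ is)) j
    decomposition j = begin
      x j
        ≡⟨ x≈ j ⟩
      rx j + l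
        -- A zero term with factor `- m + m` is inserted, making the regrouping a semiring identity
        -- in which `- m` is an independent variable.
        ≡⟨ +-identityʳ _ ⟨
      (rx j + l) + 0#
        ≡⟨ cong ((rx j + l) +_) (zeroˡ _) ⟨
      (rx j + l) + 0# * (rk j + l′)
        ≡⟨ cong (λ z → (rx j + l) + z * (rk j + l′)) (-‿inverseˡ m) ⟨
      (rx j + l) + (- m + m) * (rk j + l′)
        ≡⟨ solve 6 (λ x l n m r l′ → (x :+ l) :+ (n :+ m) :* (r :+ l′)
                     := (x :+ n :* r) :+ (m :* (r :+ l′) :+ (l :+ n :* l′)))
             refl (rx j) l (- m) m (rk j) l′ ⟩
      (rx j + - m * rk j) + (m * (rk j + l′) + (l + - m * l′))
        ≡⟨ cong₂ (λ p q → (rx j + p) + (m * q + (l + - m * l′)))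
             (sym (-‿distribˡ-* m (rk j))) (sym (k≈ j)) ⟩
      proj rk rx j + (m * w i j + (l + - m * l′))
        ≡⟨ cong (λ z → proj rk rx j + (m * w i j + z)) combine ⟨
      proj rk rx j + lincomb coeffs (family w (i ∷ is)) j ∎
      where
      l  = lincomb c  (family w is) j
      l′ = lincomb c′ (family w is) j
      combine : lincomb (coeffs ∘ suc) (family w is) j ≡ l + - m * l′
      combine = ∑-linear (- m) λ p →
        solve 4 (λ c n c′ v → (c :+ n :* c′) :* v := c :* v :+ n :* (c′ :* v))
          refl (c p) (- m) (c′ p) (family w is p j)

  ⊩⇒InSpan : ∀ {A : Set} {d k} (w : A → V d) (is : Vec A k) {x} →
             span w is ⊩ x → InSpan x (family w is)
  ⊩⇒InSpan w is {x} p with c , eq ← residual-decomposition w is x =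
    c , λ j → trans (eq j) (trans (cong (_+ _) (p j)) (+-identityˡ _))

  InSpan⇒⊩ : ∀ {A : Set} {d k} (w : A → V d) (is : Vec A k) {x} →
             InSpan x (family w is) → span w is ⊩ x
  InSpan⇒⊩ w is = linear-lincomb (residual-linear (span w is)) (λ p → ⊩-∈ {K = span w is} (member is p))
    where
    member : ∀ {k} (is : Vec _ k) p → family w is p ∈ span w is
    member (i ∷ is) zero    = here refl
    member (i ∷ is) (suc p) = there (member is p)

  -- A relation with nonzero leading coefficient could be solved for the leading vector, placing it
  -- in the span of the others.
  LinIndep-∷ : ∀ {d k} {vs : Fin (suc k) → V d} → ¬ InSpan (vs zero) (vs ∘ suc) →
               LinIndep (vs ∘ suc) → LinIndep vs
  LinIndep-∷ {k = k} {vs} ¬span ind c eq = λ { zero → c₀≡0 ; (suc p) → rest p }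
    where
    c₀≡0 : c zero ≡ 0#
    c₀≡0 with c zero ≟ 0#
    ... | yes p = p
    ... | no ¬p = contradiction ((λ p → b * c (suc p)) , solved) ¬span
      where
      b = - ((c zero) ⁻¹)
      solved : ∀ j → vs zero j ≡ lincomb (λ p → b * c (suc p)) (vs ∘ suc) j
      solved j = begin
        vs zero j
          ≡⟨ inverse-* (vs zero j) ¬p ⟨
        (c zero) ⁻¹ * (c zero * vs zero j)
          ≡⟨ cong ((c zero) ⁻¹ *_) (+-inverseˡ-unique _ l (eq j)) ⟩
        (c zero) ⁻¹ * - l
          ≡⟨ trans (sym (-‿distribʳ-* _ l)) (-‿distribˡ-* _ l) ⟩
        b * l
          ≡⟨ trans (cong (_+ b * l) (∑-0 {k})) (+-identityˡ _) ⟨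
        ∑ {k} (λ _ → 0#) + b * l
          ≡⟨ ∑-linear {k} b (λ p → trans (*-assoc b (c (suc p)) (vs (suc p) j)) (sym (+-identityˡ _))) ⟨
        lincomb (λ p → b * c (suc p)) (vs ∘ suc) j ∎
        where l = lincomb (c ∘ suc) (vs ∘ suc) j
    rest : ∀ p → c (suc p) ≡ 0#
    rest = ind (c ∘ suc) λ j → trans (sym (+-identityˡ _))
      (trans (cong (_+ lincomb (c ∘ suc) (vs ∘ suc) j) (sym (c₀*≡0 j))) (eq j))
      where
      c₀*≡0 : ∀ j → c zero * vs zero j ≡ 0#
      c₀*≡0 j = trans (cong (_* vs zero j) c₀≡0) (zeroˡ _)

  SameLine⇒⊩ : ∀ {d} {v w : V d} → SameLine v w → (v ∷ []) ⊩ w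
  SameLine⇒⊩ {v = v} (a , _ , eq) = linear-• (proj-linear v) (proj-self v) eq

  ⊩⇒SameLine : ∀ {d} {v w : V d} → NonZero w → (v ∷ []) ⊩ w → SameLine w v
  ⊩⇒SameLine {v = v} {w} w≉0 p = m ⁻¹ , ⁻¹≢0 m≢0 , SameLine-sym m≢0 eq
    where
    m = projCoeff v w
    eq = proj-kernel v w p
    m≢0 = multiple≢0 w≉0 eq

-- Listing the tuples counted by `EtaStar`.

HasCard-unique : ∀ R {T m k} {P Q : Vec (Fin T) m → Set} {xs} → LinAlg.HasCard R P k →
                 (∀ t → P t ⇔ Q t) → Unique xs → (∀ t → Q t ⇔ (t ∈ xs)) → k ≡ length xs
HasCard-unique R (ys , !ys , refl , P⇔ys) P⇔Q !xs Q⇔xs =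
  -- Duplicate-free lists with the same members are permutations of each other.
  ↭-length (∼bag⇒↭ (unique∧set⇒bag !ys !xs λ {t} →
    mk⇔ (to (Q⇔xs t) ∘ to (P⇔Q t) ∘ from (P⇔ys t))
        (to (P⇔ys t) ∘ from (P⇔Q t) ∘ from (Q⇔xs t))))

module Enumeration (R : RealField) {d T : ℕ} (ws : Fin T → LinAlg.V R d) where
  open LinAlg R
  open Projections R using (spanMatroid; family; span; ⊩⇒InSpan; InSpan⇒⊩; LinIndep-∷)
  open Matroid (spanMatroid d)
  open NBC (spanMatroid d)
  open import Data.Nat using (_+_; _≤_; _<_; z<s)
  open import Data.Nat.Properties using
    ( _<?_; ≤-refl; ≤-antisym; <⇒≤; m<n⇒m<1+n; n<1+n; ≮⇒≥; <⇒≱; m<1+n⇒m≤n; <-irrefl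
    ; <-trans)
  open import Data.List using ([]; _∷_; _++_)
  open import Data.Vec using ([]; _∷_)
  open import Data.Vec.Relation.Unary.All using ([]; _∷_)
  open import Data.List.Relation.Unary.All using ([])
  open import Data.List.Relation.Unary.Unique.Propositional using ([]; _∷_)

  below : ∀ t → t ≤ T → List (Fin T)
  below zero    _ = []
  below (suc t) p = fromℕ< p ∷ below t (<⇒≤ p)

  ∈-below⁻ : ∀ t p {j} → j ∈ below t p → toℕ j < t
  ∈-below⁻ (suc t) p (here refl) rewrite toℕ-fromℕ< p = n<1+n t
  ∈-below⁻ (suc t) p (there i)   = m<n⇒m<1+n (∈-below⁻ t _ i)

  fromℕ<-unique : ∀ {t} (p : t < T) {j : Fin T} → toℕ j < suc t → ¬ (toℕ j < t) → j ≡ fromℕ< p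
  fromℕ<-unique p j<1+t j≮t = toℕ-injective
    (trans (≤-antisym (m<1+n⇒m≤n j<1+t) (≮⇒≥ j≮t)) (sym (toℕ-fromℕ< p)))

  ∈-below⁺ : ∀ t p {j} → toℕ j < t → j ∈ below t p
  ∈-below⁺ (suc t) p {j} j<1+t with toℕ j <? t
  ... | yes j<t = there (∈-below⁺ t _ j<t)
  ... | no  j≮t = here (fromℕ<-unique p j<1+t j≮t)

  pointsBelow : ∀ t → t ≤ T → List (V d)
  pointsBelow t p = map ws (below t p)

  points : List (V d)
  points = pointsBelow T ≤-refl

  -- Mirrors the recursion of `nbc`, so that its length is that count. The largest index of a tuple
  -- is its last entry, hence `_∷ʳ_`.
  nbcTuples : List (V d) → ∀ t → t ≤ T → ∀ m → List (Vec (Fin T) m)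
  -- Empty even for `m = 0`: some index must remain below every chosen one, which encodes `0 < i_1`,
  -- and `0 < T` for the empty tuple.
  nbcTuples K zero    p m       = []
  nbcTuples K (suc t) p zero    = [] ∷ []
  nbcTuples K (suc t) p (suc m) = nbcTuples K t (<⇒≤ p) (suc m) ++
    (if does (covers? K (ws (fromℕ< p)) (pointsBelow t (<⇒≤ p))) then []
     else map (_∷ʳ fromℕ< p) (nbcTuples (ws (fromℕ< p) ∷ K) t (<⇒≤ p) m))

  length-nbcTuples : ∀ K t p m → length (nbcTuples K t p m) ≡ nbc K (pointsBelow t p) m
  length-nbcTuples K zero    p m       = refl
  length-nbcTuples K (suc t) p zero    = refl
  length-nbcTuples K (suc t) p (suc m) with covers? K (ws (fromℕ< p)) (pointsBelow t (<⇒≤ p))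
  ... | yes _ = trans (length-++ (nbcTuples K t _ (suc m)))
                  (cong (_+ 0) (length-nbcTuples K t _ (suc m)))
  ... | no  _ = trans (length-++ (nbcTuples K t _ (suc m)))
                  (cong₂ _+_ (length-nbcTuples K t _ (suc m))
                    (trans (length-map (_∷ʳ _) (nbcTuples (ws (fromℕ< p) ∷ K) t _ m))
                      (length-nbcTuples _ t _ m)))

  -- Condition (2) read in the contraction by `K`; the case `K = []` is `Minimal`.
  MinimalMod : ∀ {m} → List (V d) → Vec (Fin T) m → Set
  MinimalMod K []       = ⊤
  MinimalMod K (i ∷ is) =
    (∀ j → span ws (i ∷ is) ++ K ⊢ ws j → i Fin.≤ j) × MinimalMod K is

  Below : ∀ {m} → ℕ → Vec (Fin T) m → Set
  Below t = VAll.All (λ i → toℕ i < t)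

  -- Linear independence is omitted, being implied by minimality and the ordering.
  IsNBC : ∀ {m} → List (V d) → ℕ → Vec (Fin T) m → Set
  IsNBC K t is = 0 < t × Below t is × Increasing ws 0 is × MinimalMod K is

  below-∷ʳ⁺ : ∀ {m t s} (is : Vec (Fin T) m) → Below t is → toℕ s < t → Below t (is ∷ʳ s)
  below-∷ʳ⁺ []       []            s<t = s<t ∷ []
  below-∷ʳ⁺ (i ∷ is) (i<t ∷ below) s<t = i<t ∷ below-∷ʳ⁺ is below s<t

  below-last : ∀ {m t s} (is : Vec (Fin T) m) → Below t (is ∷ʳ s) → toℕ s < t
  below-last []       (s<t ∷ _)   = s<t
  below-last (i ∷ is) (_ ∷ below) = below-last is below

  increasing-∷ʳ⁻ : ∀ {m p t} (is : Vec (Fin T) m) → Increasing ws p (is ∷ʳ t) →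
                   Increasing ws p is × Below (toℕ t) is × p < toℕ t
  increasing-∷ʳ⁻ []       (p<t , _) = tt , [] , p<t
  increasing-∷ʳ⁻ (i ∷ is) (p<i , inc) with inc′ , below , i<t ← increasing-∷ʳ⁻ is inc =
    (p<i , inc′) , i<t ∷ below , <-trans p<i i<t

  increasing-∷ʳ⁺ : ∀ {m p t} (is : Vec (Fin T) m) → Increasing ws p is → Below (toℕ t) is →
                   p < toℕ t → Increasing ws p (is ∷ʳ t)
  increasing-∷ʳ⁺ []       _           _             p<t = p<t , tt
  increasing-∷ʳ⁺ (i ∷ is) (p<i , inc) (i<t ∷ below) p<t =
    p<i , increasing-∷ʳ⁺ is inc below i<t

  span-∷ʳ : ∀ {m t} (is : Vec (Fin T) m) K → span ws (is ∷ʳ t) ++ K ≡ span ws is ++ ws t ∷ K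
  span-∷ʳ []       K = refl
  span-∷ʳ (i ∷ is) K = cong (ws i ∷_) (span-∷ʳ is K)

  -- The last vector belongs to every span occurring in the condition, so it can be moved into `K`.
  minimal-∷ʳ : ∀ {m t K} (is : Vec (Fin T) m) → MinimalMod K (is ∷ʳ t) ⇔
               (MinimalMod (ws t ∷ K) is × (∀ j → ws t ∷ K ⊢ ws j → t Fin.≤ j))
  minimal-∷ʳ [] = mk⇔ (λ (min , _) → tt , min) (λ (_ , min) → min , tt)
  minimal-∷ʳ {t = t} {K} (i ∷ is) = mk⇔
    (λ (min , mins) → let mins′ , last = to (minimal-∷ʳ is) mins in
      ((λ j → min j ∘ subst (_⊢ ws j) (sym (span-∷ʳ (i ∷ is) K))) , mins′) , last)
    (λ ((min , mins) , last) →
      (λ j → min j ∘ subst (_⊢ ws j) (span-∷ʳ (i ∷ is) K)) , from (minimal-∷ʳ is) (mins , last))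

  -- `below t` consists exactly of the indices less than `t`, so an uncovered point is minimal in
  -- its flat over `K`; `last-free` is the converse.
  last-minimal : ∀ {K t} (p : t < T) → ¬ Covers K (ws (fromℕ< p)) (pointsBelow t (<⇒≤ p)) →
                 ∀ j → ws (fromℕ< p) ∷ K ⊢ ws j → fromℕ< p Fin.≤ j
  last-minimal {t = t} p ¬c j q rewrite toℕ-fromℕ< p =
    ≮⇒≥ λ j<t → ¬c (lose (∈-map⁺ ws (∈-below⁺ t _ j<t)) q)

  last-free : ∀ {K t} (p : t < T) → (∀ j → ws (fromℕ< p) ∷ K ⊢ ws j → fromℕ< p Fin.≤ j) →
              ¬ Covers K (ws (fromℕ< p)) (pointsBelow t (<⇒≤ p))
  last-free {t = t} p min c with x , x∈ , q ← find c with j , j∈ , refl ← ∈-map⁻ ws x∈ =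
    <⇒≱ (∈-below⁻ t _ j∈) (subst (_≤ toℕ j) (toℕ-fromℕ< p) (min j q))

  nbcTuples-sound : ∀ K t p m {is} → is ∈ nbcTuples K t p m → IsNBC K t is
  nbcTuples-sound K (suc t) p zero    (here refl) = z<s , [] , tt , tt
  nbcTuples-sound K (suc t) p (suc m) i
    with covers? K (ws (fromℕ< p)) (pointsBelow t (<⇒≤ p))
       | ∈-++⁻ (nbcTuples K t _ (suc m)) i
  ... | _ | inj₁ i′ with _ , below , inc , min ← nbcTuples-sound K t _ (suc m) i′ =
        z<s , VAll.map m<n⇒m<1+n below , inc , min
  ... | no ¬c | inj₂ i′ with js , j∈ , refl ← ∈-map⁻ (_∷ʳ fromℕ< p) i′
        with 0<t , below , inc , min ← nbcTuples-sound _ t _ m j∈ =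
        z<s , below-∷ʳ⁺ js (VAll.map m<n⇒m<1+n below) (subst (_< suc t) t≡ (n<1+n t)) ,
        increasing-∷ʳ⁺ js inc (subst (λ t → Below t js) t≡ below) (subst (0 <_) t≡ 0<t) ,
        from (minimal-∷ʳ js) (min , last-minimal {K} p ¬c)
    where
    t≡ : t ≡ toℕ (fromℕ< p)
    t≡ = sym (toℕ-fromℕ< p)

  nbcTuples-complete : ∀ K t p m {is} → IsNBC K t is → is ∈ nbcTuples K t p m
  nbcTuples-complete K (suc t) p zero    {[]} _ = here refl
  nbcTuples-complete K (suc t) p (suc m) {is} (_ , below , inc , min) with initLast is
  ... | js , s , refl
    with inc′ , below′ , 0<s ← increasing-∷ʳ⁻ js inc
       | min′ , last ← to (minimal-∷ʳ js) min
    with toℕ s <? t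
  ... | yes s<t = ∈-++⁺ˡ (nbcTuples-complete K t _ (suc m)
        (<-trans 0<s s<t ,
         below-∷ʳ⁺ js (VAll.map (λ i<s → <-trans i<s s<t) below′) s<t , inc , min))
  -- The last entry is now `t` itself, and its minimality excludes the covered case.
  ... | no  s≮t with refl ← fromℕ<-unique p (below-last js below) s≮t
    with covers? K (ws (fromℕ< p)) (pointsBelow t (<⇒≤ p))
  ... | yes c = contradiction c (last-free {K} p last)
  ... | no  _ = ∈-++⁺ʳ (nbcTuples K t _ (suc m)) (∈-map⁺ (_∷ʳ fromℕ< p)
        (nbcTuples-complete _ t _ m
          (subst (0 <_) t≡ 0<s , subst (λ t → Below t js) t≡ below′ , inc′ , min′)))
    where
    t≡ : toℕ (fromℕ< p) ≡ t
    t≡ = toℕ-fromℕ< p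

  nbcTuples-unique : ∀ K t p m → Unique (nbcTuples K t p m)
  nbcTuples-unique K zero    p m       = []
  nbcTuples-unique K (suc t) p zero    = All.[] ∷ []
  nbcTuples-unique K (suc t) p (suc m) with covers? K (ws (fromℕ< p)) (pointsBelow t (<⇒≤ p))
  ... | yes _ = ++⁺ (nbcTuples-unique K t _ (suc m)) [] λ ()
  ... | no  _ = ++⁺ (nbcTuples-unique K t _ (suc m))
    (map⁺ (λ {xs} {ys} → ∷ʳ-injectiveˡ xs ys) (nbcTuples-unique _ t _ m)) disjoint
    where
    disjoint : ∀ {is} → ¬ (is ∈ nbcTuples K t _ (suc m) ×
                           is ∈ map (_∷ʳ fromℕ< p) (nbcTuples (ws (fromℕ< p) ∷ K) t _ m))
    disjoint (i , i′) with js , _ , refl ← ∈-map⁻ (_∷ʳ fromℕ< p) i′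
      with _ , below , _ ← nbcTuples-sound K t _ (suc m) i
      = <-irrefl (toℕ-fromℕ< p) (below-last js below)

  InB⇔IsNBC : ∀ {m} → (∀ i → NonZero (ws i)) → (is : Vec (Fin T) m) →
              InB ws m is ⇔ IsNBC [] T is
  InB⇔IsNBC ws≉0 is = mk⇔
    (λ (0<T , inc , min , _) → 0<T , VAll.universal toℕ<n is , inc , minimal⁺ is min)
    (λ (0<T , _ , inc , min) → 0<T , inc , minimal⁻ is min , independent is inc (minimal⁻ is min))
    where
    minimal⁺ : ∀ {m} (is : Vec (Fin T) m) → Minimal ws is → MinimalMod [] is
    minimal⁺ []       _            = tt
    minimal⁺ (i ∷ is) (min , mins) =
      (λ j → min j ∘ ⊩⇒InSpan ws (i ∷ is) ∘ subst (_⊢ ws j) (++-identityʳ (span ws (i ∷ is)))) , minimal⁺ is mins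
    minimal⁻ : ∀ {m} (is : Vec (Fin T) m) → MinimalMod [] is → Minimal ws is
    minimal⁻ []       _            = tt
    minimal⁻ (i ∷ is) (min , mins) =
      (λ j → min j ∘ subst (_⊢ ws j) (sym (++-identityʳ (span ws (i ∷ is)))) ∘ InSpan⇒⊩ ws (i ∷ is)) ,
      minimal⁻ is mins
    independent : ∀ {m p} (is : Vec (Fin T) m) → Increasing ws p is → Minimal ws is →
                  LinIndep (family ws is)
    independent []            _               _          c eq ()
    independent (i ∷ [])      _               _          =
      LinIndep-∷ {vs = family ws (i ∷ [])} (λ (_ , eq) → ws≉0 i eq) (λ c eq ())
    -- If the first vector lay in the span of the rest, minimality of the second entry would put
    -- that entry at or below `i`, against the ordering.
    independent (i ∷ is@(_ ∷ _)) (_ , inc@(i<j , _)) (_ , mins@(min , _)) =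
      LinIndep-∷ {vs = family ws (i ∷ is)} (<⇒≱ i<j ∘ min i) (independent is inc mins)

  EtaStar-nbc : ∀ {m k} → (∀ i → NonZero (ws i)) → EtaStar ws m k → k ≡ nbc [] points m
  EtaStar-nbc {m} ws≉0 η = trans
    (HasCard-unique R η (InB⇔IsNBC ws≉0) (nbcTuples-unique [] T ≤-refl m)
      (λ _ → mk⇔ (nbcTuples-complete [] T ≤-refl m) (nbcTuples-sound [] T ≤-refl m)))
    (length-nbcTuples [] T ≤-refl m)

-- Change of representatives, and contraction as projection.

module Points (R : RealField) {d : ℕ} where
  open LinAlg R
  open Projections R
  open NBC (spanMatroid d)
  open import Data.List using ([]; _∷_; _++_)

  -- Agreement as sets of vectors only: order and repetitions are left free.
  Enumerates : ∀ {T} → List (V d) → (Fin T → V d) → Set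
  Enumerates L xs = (∀ j → xs j ∈ L) × (∀ {x} → x ∈ L → ∃ λ j → x ≡ xs j)

  points-enumerates : ∀ {T} (ws : Fin T → V d) → Enumerates (Enumeration.points R ws) ws
  points-enumerates ws =
    (λ j → ∈-map⁺ ws (∈-below⁺ _ _ (toℕ<n j))) ,
    (λ x∈ → let j , _ , eq = ∈-map⁻ ws x∈ in j , eq)
    where open Enumeration R ws

  ∷-enumerates : ∀ {T} u {ws : Fin T → V d} {L} → Enumerates L ws → Enumerates (u ∷ L) (u F.∷ ws)
  ∷-enumerates u (ws∈L , L∈ws) =
    (λ { zero → here refl ; (suc j) → there (ws∈L j) }) ,
    (λ { (here eq) → zero , eq ; (there i) → let j , eq = L∈ws i in suc j , eq })

  map-enumerates : ∀ {T} (g : V d → V d) {ws : Fin T → V d} {L} →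
                   Enumerates L ws → Enumerates (map g L) (g ∘ ws)
  map-enumerates g (ws∈L , L∈ws) =
    (λ j → ∈-map⁺ g (ws∈L j)) ,
    (λ x∈ → let y , y∈ , eq = ∈-map⁻ g x∈ ; j , eq′ = L∈ws y∈ in j , trans eq (cong g eq′))

  enumerates-All : ∀ {T} {P : V d → Set} {xs : Fin T → V d} {L} →
                   Enumerates L xs → (∀ j → P (xs j)) → All P L
  enumerates-All {P = P} (_ , L∈xs) h =
    All.tabulate λ x∈ → let j , eq = L∈xs x∈ in subst P (sym eq) (h j)

  enumerates-covers : ∀ {S T} {xs : Fin S → V d} {ys : Fin T → V d} {L L′} →
                      Enumerates L xs → Enumerates L′ ys →
                      (∀ i → ∃ λ j → SameLine (xs i) (ys j)) →
                      All (λ u → Covers [] u L′) L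
  enumerates-covers e (ys∈L′ , _) h = enumerates-All e λ i →
    let j , s = h i in lose (ys∈L′ j) (SameLine⇒⊩ s)

  -- Vectors on one line cover each other and nonzero vectors are not loops, so `nbc-invariant`
  -- applies. Repeated points, which may arise among projections, are harmless.
  nbc-samePoints : ∀ {S T} {xs : Fin S → V d} {ys : Fin T → V d} {L L′} →
                   Enumerates L xs → Enumerates L′ ys →
                   (∀ i → NonZero (xs i)) → (∀ j → NonZero (ys j)) →
                   SamePointSet xs ys → ∀ m → nbc [] L m ≡ nbc [] L′ m
  nbc-samePoints e e′ xs≉0 ys≉0 (xs⊆ys , ys⊆xs) = nbc-invariant
    (enumerates-All e xs≉0) (enumerates-All e′ ys≉0)
    (enumerates-covers e e′ xs⊆ys) (enumerates-covers e′ e ys⊆xs)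

  -- Gram-Schmidt treats the last list entry first, and for `u` this first step is `proj u` itself.
  residual-proj : ∀ (u : V d) X x →
                  residual (X ++ u ∷ []) x ≡ residual (map (proj u) X ++ []) (proj u x)
  residual-proj u []      x = refl
  residual-proj u (k ∷ X) x = cong₂ proj (residual-proj u X k) (residual-proj u X x)

  -- Contraction by `u` is realised by projecting along `u`; the projected vectors stay in the
  -- ambient space.
  nbc-proj : ∀ (u : V d) L m → nbc (u ∷ []) L m ≡ nbc [] (map (proj u) L) m
  nbc-proj u = nbc-map (proj u) λ X x →
    mk⇔ (subst (_≈ᵥ 0ᵥ) (residual-proj u X x)) (subst (_≈ᵥ 0ᵥ) (sym (residual-proj u X x)))

-- The deletion-contraction identity.

open import Data.Nat using (_+_; _∸_; _≤_)
open import Data.Vec.Functional using (_∷_)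

theorem1 : (R : RealField) → let open LinAlg R in
  (n : ℕ) → 1 ≤ n →
  (T : ℕ) (ws : Fin T → V (suc n)) → DistinctPoints ws →
  (u : V (suc n)) → NonZero u → ¬ (∃ λ i → SameLine (ws i) u) →
  (T₁ : ℕ) (vs : Fin T₁ → V (suc n)) → DistinctPoints vs → SamePointSet vs (u ∷ ws) →
  (T₂ : ℕ) (qs : Fin T₂ → V (suc n)) → DistinctPoints qs →
  SamePointSet qs (λ i → proj u (ws i)) →
  (a b c : ℕ) → EtaStar vs n a → EtaStar ws n b → EtaStar qs (n ∸ 1) c →
  a ≡ b + c
theorem1 R n@(suc n′) _ _ ws (ws≉0 , _) u u≉0 u∉ws _ vs (vs≉0 , _) vs~ _ qs (qs≉0 , _) qs~ a b c ηa ηb ηc =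
  begin
  a
    ≡⟨ EtaStar-nbc vs vs≉0 ηa ⟩
  nbc [] (points vs) n
    -- By order independence `u` may be taken as the largest point, whatever the order of `vs`.
    ≡⟨ nbc-samePoints (points-enumerates vs) (∷-enumerates u (points-enumerates ws)) vs≉0
         (λ { zero → u≉0 ; (suc j) → ws≉0 j }) vs~ n ⟩
  nbc [] (u List.∷ points ws) n
    ≡⟨ nbc-free n′ u-free ⟩
  nbc [] (points ws) n + nbc List.[ u ] (points ws) n′
    ≡⟨ cong₂ _+_ (sym (EtaStar-nbc ws ws≉0 ηb)) (nbc-proj u (points ws) n′) ⟩
  b + nbc [] (map (proj u) (points ws)) n′
    ≡⟨ cong (b +_) (nbc-samePoints (points-enumerates qs)
         (map-enumerates (proj u) (points-enumerates ws)) qs≉0 ws∦u qs~ n′) ⟨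
  b + nbc [] (points qs) n′
    ≡⟨ cong (b +_) (EtaStar-nbc qs qs≉0 ηc) ⟨
  b + c ∎
  where
  open LinAlg R
  open Projections R
  open ≡-Reasoning
  open import Data.List using ([])
  open Enumeration R
  open Points R {suc n}
  open NBC (spanMatroid (suc n))
  -- Since `residual` of the one-element list is `proj u`, this also says that no projected vector
  -- vanishes.
  ws∦u : ∀ j → ¬ (List.[ u ] ⊩ ws j)
  ws∦u j q = u∉ws (j , ⊩⇒SameLine (ws≉0 j) q)
  u-free : ¬ Covers [] u (points ws)
  u-free c with x , x∈ , q ← find c with j , refl ← proj₂ (points-enumerates ws) x∈ = ws∦u j q
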